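{- Consider any AGP algorithm (for example AGP-Static or AGP-Static++, as described in the context) with propagation threshold $\varepsilon>0$ whose subset sampling cost within the neighborhood of each vertex $u$ is $O(\mu_u + c_{\mathrm{so}})$ in expectation, where $\mu_u$ is the expected size of the sampled subset and $c_{\mathrm{so}}$ is the non-chargeable overhead. Then for every query $q(a,b,\mathcal{O}_w,\mathbf{x})$ the expected query time of the algorithm is bounded by $$O\left(c_{\mathrm{so}} \cdot \frac{1}{\varepsilon}\sum_{i=1}^L \left\|Y_i(\mathbf{D}^{ -a}\mathbf{A}\mathbf{D}^{ -b})^i\cdot \mathbf{x}\right\|_1 + \mathrm{E}[C_{\mathrm{init}}]\right),$$ where $\mathrm{E}[C_{\mathrm{init}}]$ is the expected cost of initialization, i.e., of reading the query input $q(a,b,\mathcal{O}_w,\mathbf{x})$.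
   Context: Setting. $G=\langle V,E\rangle$ is an undirected unweighted graph with $n$ vertices; $N[u]=\{v\in V: (u,v)\in E\}$ and $d_u=|N[u]|$. $\mathbf{A}$ is the adjacency matrix and $\mathbf{D}$ the diagonal degree matrix; the entry of $\mathbf{D}^{ -a}\mathbf{A}\mathbf{D}^{ -b}$ in row $v$, column $u$ is $1/(d_v^a d_u^b)$ if $(u,v)\in E$ and $0$ otherwise. A query $q(a,b,\mathcal{O}_w,\mathbf{x})$ consists of: constants $a,b\in[0,1]$ with $a+b\ge 1$; weights $w_i\ge 0$ ($i\ge 0$) with $\sum_{i\ge0} w_i=1$ and $w_i\le\lambda^i$ for all $i\ge L_0$, for some constants $L_0\ge 0$, $\lambda\ge 1$, given by an oracle $\mathcal{O}_w$ returning in $O(1)$ time any $w_i$ and, for $0\le\Delta\le 1$, the smallest integer $L_{\mathcal{O}_w}(\Delta)=k$ with $\sum_{i\ge k} w_i\le\Delta$; and a vector $\mathbf{x}\in\mathbb{R}^n$ with nonnegative entries and $\|\mathbf{x}\|_1=1$. Put $Y_i=\sum_{k\ge i}w_k$. The query also comes with approximation parameters $\delta>0$ and a constant $c>0$, and $L=L_{\mathcal{O}_w}(c\delta)$. AGP algorithms. Set $\hat{\mathbf r}^{(0)}=\mathbf{x}$ and all other vectors to zero. For $i=0,\dots,L-1$ and each $u\in V$ with $\hat{\mathbf r}^{(i)}(u)\ne0$: independently for each $v\in N[u]$, with $p_{u,v}=\min\{1,\frac1\varepsilon\cdot\frac{Y_{i+1}}{Y_i}\cdot\frac{\hat{\mathbf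 r}^{(i)}(u)}{d_v^a d_u^b}\}$, select $v$ with probability $p_{u,v}$ (neighbors with $p_{u,v}=1$ are always selected) and for each selected $v$ increase $\hat{\mathbf r}^{(i+1)}(v)$ by $\max\{\varepsilon,\frac{Y_{i+1}}{Y_i}\cdot\frac{\hat{\mathbf r}^{(i)}(u)}{d_v^a d_u^b}\}$ at $O(1)$ cost per selected neighbor. Output $\hat{\boldsymbol\pi}=\sum_{i=0}^L\frac{w_i}{Y_i}\hat{\mathbf r}^{(i)}$ (with $w_i/Y_i:=0$ if $Y_i=0$). The algorithms differ in the value of $\varepsilon$ and in the subset sampling data structure used to select the neighbors: AGP-Static uses $\varepsilon=\frac{c^2\delta}{2L^2}$ and has $c_{\mathrm{so}}=O(\log^2 n)$; AGP-Static++ uses $\varepsilon=\frac{c^2\delta}{2(L+1)}$ and has $c_{\mathrm{so}}=O(\log n)$. The subset sampling cost splits into a part proportional to the output (charged to the selected neighbors) and the non-chargeable overhead $c_{\mathrm{so}}$, paid once for each processed pair $(i,u)$. The model of computation is the Word RAM.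
   Formalization: The cost of initialization is assumed to be at least a constant times c_so times the number of nonzero entries of x, so it covers the overhead of the level-0 pairs; with O(1) reading per entry the bound fails (uniform x on an n-cycle, constant ε, c_so = log n). -}

module Defs where

open import Algebra.Bundles using (CommutativeRing)
import Algebra.Construct.NaturalChoice.Max as Max
import Algebra.Construct.NaturalChoice.Min as Min
import Algebra.Properties.Semiring.Exp as Exp
import Algebra.Properties.Semiring.Mult as Mult
import Algebra.Properties.Semiring.Sum as Sum
open import Data.Bool.Base using (Bool; true; false; if_then_else_)
open import Data.Fin.Base using (Fin; toℕ)
import Data.Fin.Properties as Fin
open import Data.List.Base as List using (List; []; _∷_; length; filter; allFin)
open import Data.Nat.Base as ℕ using (ℕ; zero; suc)
open import Data.Product.Base using (_×_; _,_; ∃; proj₂)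
open import Level using (_⊔_; 0ℓ) renaming (suc to lsuc)
open import Relation.Binary.Bundles using (DecTotalOrder)
open import Relation.Binary.Core using (Rel)
open import Relation.Binary.Definitions using (Decidable; Symmetric)
open import Relation.Binary.Structures using (IsDecTotalOrder)
import Relation.Binary.Construct.NonStrictToStrict as Strict
open import Relation.Nullary.Decidable using (does; ¬?)
open import Relation.Nullary.Negation using (¬_)

-- The (classical) real numbers, as a Dedekind-complete ordered field with
-- decidable order.  The laws of _^ʳ_ determine real powers of positive reals
-- uniquely; _⁻¹ and _^ʳ_ are unconstrained outside their mathematical domain.

record RealNumbers c ℓ₁ ℓ₂ : Set (lsuc (c ⊔ ℓ₁ ⊔ ℓ₂)) where
  field
    commutativeRing : CommutativeRing c ℓ₁

  open CommutativeRing commutativeRing public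
    using (Carrier; _≈_; _+_; _*_; -_; _-_; 0#; 1#; semiring)

  infix  4 _≤_
  infix  9 _⁻¹
  infixr 9 _^ʳ_

  field
    _≤_             : Rel Carrier ℓ₂
    isDecTotalOrder : IsDecTotalOrder _≈_ _≤_
    +-monoˡ-≤       : ∀ z {x y} → x ≤ y → (x + z) ≤ (y + z)
    *-nonNeg        : ∀ {x y} → 0# ≤ x → 0# ≤ y → 0# ≤ (x * y)
    0≉1             : ¬ (0# ≈ 1#)
    _⁻¹             : Carrier → Carrier
    *-inverseʳ      : ∀ {x} → ¬ (x ≈ 0#) → (x * (x ⁻¹)) ≈ 1#
    supremum        : (P : Carrier → Set (c ⊔ ℓ₁ ⊔ ℓ₂)) → ∃ P →
                      (∃ λ b → ∀ x → P x → x ≤ b) →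
                      ∃ λ s → (∀ x → P x → x ≤ s) ×
                              (∀ b → (∀ x → P x → x ≤ b) → s ≤ b)

  open Strict _≈_ _≤_ public using (_<_)

  field
    _^ʳ_       : Carrier → Carrier → Carrier
    ^ʳ-cong    : ∀ {x x′ y y′} → 0# < x → x ≈ x′ → y ≈ y′ → (x ^ʳ y) ≈ (x′ ^ʳ y′)
    ^ʳ-pos     : ∀ {x} y → 0# < x → 0# < (x ^ʳ y)
    ^ʳ-1       : ∀ {x} → 0# < x → (x ^ʳ 1#) ≈ x
    ^ʳ-+       : ∀ {x} y z → 0# < x → (x ^ʳ (y + z)) ≈ ((x ^ʳ y) * (x ^ʳ z))
    ^ʳ-*       : ∀ {x y} z → 0# < x → 0# < y → ((x * y) ^ʳ z) ≈ ((x ^ʳ z) * (y ^ʳ z))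
    ^ʳ-monoʳ-≤ : ∀ {x y z} → 1# ≤ x → y ≤ z → (x ^ʳ y) ≤ (x ^ʳ z)

  decTotalOrder : DecTotalOrder c ℓ₁ ℓ₂
  decTotalOrder = record { isDecTotalOrder = isDecTotalOrder }

  open IsDecTotalOrder isDecTotalOrder public using (_≟_; _≤?_)
  open Min (DecTotalOrder.totalOrder decTotalOrder) public using () renaming (_⊓_ to min)
  open Max (DecTotalOrder.totalOrder decTotalOrder) public using () renaming (_⊔_ to max)
  open Sum semiring public using (sum)
  open Exp semiring public using (_^_)
  open Mult semiring public using () renaming (_×_ to _·_)

  infixl 7 _÷_

  -- The value 0 at a zero denominator is the convention w_i / Y_i := 0.
  _÷_ : Carrier → Carrier → Carrier
  x ÷ y = if does (y ≟ 0#) then 0# else (x * (y ⁻¹))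

  ∣_∣ : Carrier → Carrier
  ∣ x ∣ = max x (- x)

  fromℕ : ℕ → Carrier
  fromℕ k = k · 1#

  HasSum : (ℕ → Carrier) → Carrier → Set (c ⊔ ℓ₁ ⊔ ℓ₂)
  HasSum f s = ∀ η → 0# < η → ∃ λ N → ∀ m → N ℕ.≤ m →
    ∣ sum (λ (k : Fin m) → f (toℕ k)) - s ∣ < η

  Vector : ℕ → Set c
  Vector n = Fin n → Carrier

  Matrix : ℕ → Set c
  Matrix n = Fin n → Fin n → Carrier

  ‖_‖₁ : ∀ {n} → Vector n → Carrier
  ‖ v ‖₁ = sum (λ i → ∣ v i ∣)

  infixr 7 _*ₘ_ _*ᵥ_ _•_
  infixr 8 _^ₘ_

  _•_ : ∀ {n} → Carrier → Vector n → Vector n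
  (s • v) i = s * v i

  _*ᵥ_ : ∀ {n} → Matrix n → Vector n → Vector n
  (M *ᵥ v) i = sum (λ j → M i j * v j)

  _*ₘ_ : ∀ {n} → Matrix n → Matrix n → Matrix n
  (M *ₘ N) i k = sum (λ j → M i j * N j k)

  identity : ∀ {n} → Matrix n
  identity i j = if does (i Fin.≟ j) then 1# else 0#

  _^ₘ_ : ∀ {n} → Matrix n → ℕ → Matrix n
  M ^ₘ zero  = identity
  M ^ₘ suc k = M *ₘ (M ^ₘ k)

  -- ∑[1⋯ L ] f = f 1 + … + f L
  ∑[1⋯_] : ℕ → (ℕ → Carrier) → Carrier
  ∑[1⋯ L ] f = sum (λ (k : Fin L) → f (suc (toℕ k)))

-- Undirected unweighted graphs on n vertices; loops are not excluded.

record Graph (n : ℕ) : Set₁ where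
  field
    Edge  : Rel (Fin n) 0ℓ
    edge? : Decidable Edge
    sym   : Symmetric Edge

  neighbours : Fin n → List (Fin n)
  neighbours u = filter (edge? u) (allFin n)

  degree : Fin n → ℕ
  degree u = length (neighbours u)

module Propagation {c ℓ₁ ℓ₂} (R : RealNumbers c ℓ₁ ℓ₂) where

  open RealNumbers R
  open Graph

  record Query (n : ℕ) : Set (c ⊔ ℓ₁ ⊔ ℓ₂) where
    field
      a b   : Carrier
      0≤a   : 0# ≤ a
      a≤1   : a ≤ 1#
      0≤b   : 0# ≤ b
      b≤1   : b ≤ 1#
      1≤a+b : 1# ≤ (a + b)

      w     : ℕ → Carrier
      0≤w   : ∀ i → 0# ≤ w i
      ∑w≈1  : HasSum w 1#
      Λ     : Carrier
      1≤Λ   : 1# ≤ Λ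
      L₀    : ℕ
      w≤Λ^  : ∀ i → L₀ ℕ.≤ i → w i ≤ (Λ ^ i)

      Y     : ℕ → Carrier
      Y-sum : ∀ i → HasSum (λ k → w (i ℕ.+ k)) (Y i)

      -- tailIndex Δ is the least k with Y k ≤ Δ whenever there is one; for
      -- weights of infinite support there is none at Δ = 0.
      tailIndex       : Carrier → ℕ
      tailIndex-least : ∀ Δ → 0# ≤ Δ → Δ ≤ 1# → ∀ k → Y k ≤ Δ →
                        (Y (tailIndex Δ) ≤ Δ) × (tailIndex Δ ℕ.≤ k)

      x      : Vector n
      0≤x    : ∀ u → 0# ≤ x u
      ‖x‖₁≈1 : ‖ x ‖₁ ≈ 1#

      δ   : Carrier
      0<δ : 0# < δ
      γ   : Carrier             -- the constant c of the threshold c δ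
      0<γ : 0# < γ

    L : ℕ
    L = tailIndex (γ * δ)

  -- D^{-a} A D^{-b}
  propagationMatrix : ∀ {n} → Graph n → Carrier → Carrier → Matrix n
  propagationMatrix G a b v u =
    if does (edge? G u v)
    then 1# ÷ ((fromℕ (degree G v) ^ʳ a) * (fromℕ (degree G u) ^ʳ b))
    else 0#

  support : ∀ {n} → Vector n → List (Fin n)
  support r = filter (λ u → ¬? (r u ≟ 0#)) (allFin _)

  -- Finitely supported distributions, as lists of outcomes with probabilities.

  Dist : ∀ {ℓ} → Set ℓ → Set (c ⊔ ℓ)
  Dist A = List (Carrier × A)

  return : ∀ {ℓ} {A : Set ℓ} → A → Dist A
  return z = (1# , z) ∷ []

  infixl 1 _>>=_

  _>>=_ : ∀ {ℓ ℓ′} {A : Set ℓ} {B : Set ℓ′} → Dist A → (A → Dist B) → Dist B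
  []            >>= f = []
  ((p , z) ∷ d) >>= f = List.map (λ (q , y) → (p * q , y)) (f z) List.++ (d >>= f)

  bernoulli : Carrier → Dist Bool
  bernoulli p = (p , true) ∷ (1# - p , false) ∷ []

  𝔼 : ∀ {ℓ} {A : Set ℓ} → Dist A → (A → Carrier) → Carrier
  𝔼 []            f = 0#
  𝔼 ((p , z) ∷ d) f = (p * f z) + 𝔼 d f

  sampleSubset : ∀ {n} → (Fin n → Carrier) → List (Fin n) → Dist (List (Fin n))
  sampleSubset p []       = return []
  sampleSubset p (v ∷ vs) = do
    selected ← bernoulli (p v)
    S        ← sampleSubset p vs
    return (if selected then v ∷ S else S)

  -- The processing of one pair (i , u) whose entry r̂⁽ⁱ⁾(u) is ρ.
  module Step {n} (G : Graph n) (q : Query n) (ε : Carrier)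
              (i : ℕ) (u : Fin n) (ρ : Carrier) where
    open Query q

    share : Fin n → Carrier
    share v = (Y (suc i) ÷ Y i) *
              (ρ ÷ ((fromℕ (degree G v) ^ʳ a) * (fromℕ (degree G u) ^ʳ b)))

    probability : Fin n → Carrier
    probability v = min 1# ((1# ÷ ε) * share v)

    increment : Fin n → Carrier
    increment v = max ε (share v)

    selection : Dist (List (Fin n))
    selection = sampleSubset probability (neighbours G u)

    μ : Carrier
    μ = 𝔼 selection (λ S → fromℕ (length S))

    push : List (Fin n) → Vector n → Vector n
    push []      r = r
    push (v ∷ S) r = push S (λ v′ → if does (v′ Fin.≟ v) then r v′ + increment v else r v′)

  -- All running times below are functions on the model's finite outcome space
  -- of selections: sampleTime is the expected time of a subset sampling call
  -- conditioned on the subset S it returns, so that a data structure may use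
  -- arbitrary further randomness of its own, and initTime is E[C_init].
  --
  -- K, κ and B are the constants hidden in O(·).  B pays for the O(1) work per
  -- processed pair (oracle calls included) and per selected neighbour (its
  -- share in assembling the output included).
  --
  -- Reading the input entry x(u) is taken to comprise the overhead cₛₒ of
  -- processing the pair (0 , u), whence initTime-bound.  The pairs of level 0
  -- cannot be charged to the sum over i ≥ 1: for x uniform on a cycle that sum
  -- is at most L whereas n pairs of level 0 are processed.
  record AGPAlgorithm : Set (lsuc 0ℓ ⊔ c ⊔ ℓ₁ ⊔ ℓ₂) where
    field
      ε   : ∀ {n} → Graph n → Query n → Carrier
      0<ε : ∀ {n} (G : Graph n) (q : Query n) → 0# < ε G q

      cₛₒ   : ∀ {n} → Graph n → Carrier
      1≤cₛₒ : ∀ {n} (G : Graph n) → 1# ≤ cₛₒ G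

      sampleTime : ∀ {n} → Graph n → Query n → ℕ → Fin n → Carrier → List (Fin n) → Carrier
      K          : Carrier
      0≤K        : 0# ≤ K
      sampleTime-bound :
        ∀ {n} (G : Graph n) (q : Query n) i u ρ → i ℕ.< Query.L q → 0# < ρ →
        let open Step G q (ε G q) i u ρ in
        𝔼 selection (sampleTime G q i u ρ) ≤ (K * (μ + cₛₒ G))

      B   : Carrier
      0≤B : 0# ≤ B

      initTime : ∀ {n} → Graph n → Query n → Carrier
      κ        : Carrier
      0≤κ      : 0# ≤ κ
      initTime-bound :
        ∀ {n} (G : Graph n) (q : Query n) →
        (cₛₒ G * fromℕ (length (support (Query.x q)))) ≤ (κ * initTime G q)

    module _ {n} (G : Graph n) (q : Query n) where
      open Query q

      processLevel : ℕ → Vector n → List (Fin n) → Vector n × Carrier → Dist (Vector n × Carrier)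
      processLevel i r []       state      = return state
      processLevel i r (u ∷ us) (r⁺ , t) = do
        S ← selection
        processLevel i r us
          (push S r⁺ , t + (sampleTime G q i u (r u) S + B * (1# + fromℕ (length S))))
        where open Step G q (ε G q) i u (r u)

      -- The number of levels still to be processed, the current level i, r̂⁽ⁱ⁾,
      -- the part of π̂ from the levels below i, and the time spent so far.
      propagate : ℕ → ℕ → Vector n → Vector n → Carrier → Dist (Vector n × Carrier)
      propagate zero         i r π t = return ((λ v → π v + ((w i ÷ Y i) * r v)) , t)
      propagate (suc levels) i r π t = do
        (r⁺ , t⁺) ← processLevel i r (support r) ((λ _ → 0#) , t)
        propagate levels (suc i) r⁺ (λ v → π v + ((w i ÷ Y i) * r v)) t⁺

      -- The output π̂ together with the query time.
      run : Dist (Vector n × Carrier)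
      run = propagate L 0 x (λ _ → 0#) (initTime G q)

      expectedQueryTime : Carrier
      expectedQueryTime = 𝔼 run proj₂

{-# OPTIONS --safe #-}
module Submission where

-- Let M = D⁻ᵃ A D⁻ᵇ.  Each selected neighbour receives its share in expectation, as
-- min(1 , s/ε) · max(ε , s) = s, so E[r̂⁽ⁱ⁾] = Yᵢ Mⁱ x.  Every nonzero entry of r̂⁽ⁱ⁾, i ≥ 1,
-- is at least ε, so the number of processed pairs of level i is at most ‖r̂⁽ⁱ⁾‖₁ / ε; and
-- min(1 , s/ε) ≤ s/ε bounds the expected number of vertices selected at level i - 1
-- by E‖r̂⁽ⁱ⁾‖₁ / ε.  Hence mass reaching a level i ≥ 1 is charged at most twice, and the
-- pairs of level 0 are paid by the initialisation.  The expectations are never computed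
-- along the run: a downward induction over the levels bounds the expected remaining time
-- by a functional that is linear in the current vector, up to the cost of its support.

open import Algebra.Bundles using (CommutativeRing)
import Algebra.Construct.NaturalChoice.Max as Max
import Algebra.Construct.NaturalChoice.Min as Min
import Algebra.Properties.Ring as RingProperties
import Algebra.Properties.Semiring.Sum as SemiringSum
import Algebra.Solver.Ring.NaturalCoefficients.Default as Solver
open import Data.Bool.Base using (Bool; true; false; if_then_else_)
open import Data.Empty using (⊥-elim)
open import Data.Fin.Base using (Fin; zero; suc; toℕ)
import Data.Fin.Properties as Fin
open import Data.List.Base as List using (List; []; _∷_; length; filter; allFin; tabulate)
open import Data.List.Membership.Propositional.Properties using (∈-filter⁺; ∈-allFin)
open import Data.List.Relation.Unary.All as All using (All; []; _∷_)
import Data.List.Relation.Unary.All.Properties as All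
open import Data.Nat using (ℕ)
open import Data.Nat.Base as ℕ using (zero; suc)
import Data.Nat.Properties as ℕ
open import Data.Product using (_×_; ∃; _,_; proj₁; proj₂)
open import Data.Sum.Base using (_⊎_; inj₁; inj₂)
open import Function.Base using (_∘_)
open import Relation.Binary.Bundles using (DecTotalOrder)
import Relation.Binary.PropositionalEquality.Core as ≡
import Relation.Binary.Reasoning.PartialOrder as PosetReasoning
open import Relation.Nullary.Decidable using (yes; no; does; ¬?)
open import Relation.Nullary.Negation using (¬_)
open import Relation.Unary using (Pred; Decidable)
open import Defs

module RealProperties {c ℓ₁ ℓ₂} (R : RealNumbers c ℓ₁ ℓ₂) where

  open RealNumbers R
  open CommutativeRing commutativeRing public
    using (ring; commutativeSemiring; refl; sym; trans; reflexive
          ; +-cong; +-congˡ; +-congʳ; *-cong; *-congˡ; *-congʳ; -‿cong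
          ; +-identityˡ; +-identityʳ; *-identityˡ; *-identityʳ
          ; distribˡ; distribʳ; +-comm; +-assoc; *-comm; *-assoc; zeroˡ; zeroʳ
          ; -‿inverseʳ; -‿inverseˡ)
  open RingProperties ring using (-‿distribˡ-*; -‿involutive)
  open SemiringSum semiring public
    using (sum-cong-≋; sum-replicate-zero; ∑-distrib-+; ∑-comm; *-distribˡ-sum; *-distribʳ-sum)
  open DecTotalOrder decTotalOrder public
    using (poset; total; antisym)
    renaming (refl to ≤-refl; reflexive to ≤-reflexive; trans to ≤-trans)
  open Min (DecTotalOrder.totalOrder decTotalOrder) public
    using (x⊓y≤x; x⊓y≤y; ⊓-glb; x≤y⇒x⊓y≈x; x≤y⇒y⊓x≈x)
  open Max (DecTotalOrder.totalOrder decTotalOrder) public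
    using (x≤x⊔y; x≤y⊔x; x≤y⇒x⊔y≈y; x≤y⇒y⊔x≈y; ⊔-lub)
  open Solver commutativeSemiring public using (solve; _:=_; _:+_; _:*_; con)
  open PosetReasoning poset

  +-mono-≤ : ∀ {x y z w} → x ≤ y → z ≤ w → x + z ≤ y + w
  +-mono-≤ {x} {y} {z} {w} x≤y z≤w = begin
    x + z  ≤⟨ +-monoˡ-≤ z x≤y ⟩
    y + z  ≈⟨ +-comm y z ⟩
    z + y  ≤⟨ +-monoˡ-≤ y z≤w ⟩
    w + y  ≈⟨ +-comm w y ⟩
    y + w  ∎

  +-monoʳ-≤ : ∀ z {x y} → x ≤ y → z + x ≤ z + y
  +-monoʳ-≤ z = +-mono-≤ ≤-refl

  +-nonNeg : ∀ {x y} → 0# ≤ x → 0# ≤ y → 0# ≤ x + y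
  +-nonNeg 0≤x 0≤y = ≤-trans (≤-reflexive (sym (+-identityˡ 0#))) (+-mono-≤ 0≤x 0≤y)

  x≤x+y : ∀ x {y} → 0# ≤ y → x ≤ x + y
  x≤x+y x 0≤y = ≤-trans (≤-reflexive (sym (+-identityʳ x))) (+-monoʳ-≤ x 0≤y)

  x≤y+x : ∀ x {y} → 0# ≤ y → x ≤ y + x
  x≤y+x x 0≤y = ≤-trans (x≤x+y x 0≤y) (≤-reflexive (+-comm x _))

  x-y+y≈x : ∀ x y → (x - y) + y ≈ x
  x-y+y≈x x y = trans (+-assoc x (- y) y) (trans (+-congˡ (-‿inverseˡ y)) (+-identityʳ x))

  x≤y⇒0≤y-x : ∀ {x y} → x ≤ y → 0# ≤ y - x
  x≤y⇒0≤y-x {x} {y} x≤y = ≤-trans (≤-reflexive (sym (-‿inverseʳ x))) (+-monoˡ-≤ (- x) x≤y)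

  x≤0⇒0≤-x : ∀ {x} → x ≤ 0# → 0# ≤ - x
  x≤0⇒0≤-x {x} x≤0 = ≤-trans (x≤y⇒0≤y-x x≤0) (≤-reflexive (+-identityˡ (- x)))

  0≤-x⇒x≤0 : ∀ {x} → 0# ≤ - x → x ≤ 0#
  0≤-x⇒x≤0 {x} 0≤-x = begin
    x        ≈⟨ +-identityˡ x ⟨
    0# + x   ≤⟨ +-monoˡ-≤ x 0≤-x ⟩
    - x + x  ≈⟨ -‿inverseˡ x ⟩
    0#       ∎

  *-monoˡ-≤ : ∀ {z x y} → 0# ≤ z → x ≤ y → z * x ≤ z * y
  *-monoˡ-≤ {z} {x} {y} 0≤z x≤y = begin
    z * x                ≤⟨ x≤y+x (z * x) (*-nonNeg 0≤z (x≤y⇒0≤y-x x≤y)) ⟩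
    z * (y - x) + z * x  ≈⟨ solve 3 (λ z d x → z :* d :+ z :* x := z :* (d :+ x)) refl z (y - x) x ⟩
    z * ((y - x) + x)    ≈⟨ *-congˡ (x-y+y≈x y x) ⟩
    z * y                ∎

  *-monoʳ-≤ : ∀ {z x y} → 0# ≤ z → x ≤ y → x * z ≤ y * z
  *-monoʳ-≤ 0≤z x≤y =
    ≤-trans (≤-reflexive (*-comm _ _)) (≤-trans (*-monoˡ-≤ 0≤z x≤y) (≤-reflexive (*-comm _ _)))

  nonNeg*nonPos : ∀ {x y} → 0# ≤ x → y ≤ 0# → x * y ≤ 0#
  nonNeg*nonPos {x} 0≤x y≤0 = ≤-trans (*-monoˡ-≤ 0≤x y≤0) (≤-reflexive (zeroʳ x))

  0≤1 : 0# ≤ 1#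
  0≤1 with total 0# 1#
  ... | inj₁ 0≤1 = 0≤1
  ... | inj₂ 1≤0 = begin
    0#            ≤⟨ *-nonNeg 0≤-1 0≤-1 ⟩
    - 1# * - 1#   ≈⟨ -‿distribˡ-* 1# (- 1#) ⟨
    - (1# * - 1#) ≈⟨ -‿cong (*-identityˡ (- 1#)) ⟩
    - (- 1#)      ≈⟨ -‿involutive 1# ⟩
    1#            ∎
    where
    0≤-1 : 0# ≤ - 1#
    0≤-1 = x≤0⇒0≤-x 1≤0

  0<⇒≉0 : ∀ {x} → 0# < x → ¬ x ≈ 0#
  0<⇒≉0 (_ , 0≉x) x≈0 = 0≉x (sym x≈0)

  1≰0 : ¬ 1# ≤ 0#
  1≰0 1≤0 = 0≉1 (antisym 0≤1 1≤0)

  1≤⇒0< : ∀ {x} → 1# ≤ x → 0# < x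
  1≤⇒0< 1≤x = ≤-trans 0≤1 1≤x , λ 0≈x → 1≰0 (≤-trans 1≤x (≤-reflexive (sym 0≈x)))

  0≤∧≉0⇒0< : ∀ {x} → 0# ≤ x → ¬ x ≈ 0# → 0# < x
  0≤∧≉0⇒0< 0≤x x≉0 = 0≤x , λ 0≈x → x≉0 (sym 0≈x)

  *-inverseˡ : ∀ {x} → ¬ x ≈ 0# → x ⁻¹ * x ≈ 1#
  *-inverseˡ x≉0 = trans (*-comm _ _) (*-inverseʳ x≉0)

  ⁻¹-nonNeg : ∀ {x} → 0# < x → 0# ≤ x ⁻¹
  ⁻¹-nonNeg {x} 0<x with total 0# (x ⁻¹)
  ... | inj₁ 0≤x⁻¹ = 0≤x⁻¹
  ... | inj₂ x⁻¹≤0 = ⊥-elim (1≰0 (≤-trans (≤-reflexive (sym (*-inverseʳ (0<⇒≉0 0<x))))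
                                          (nonNeg*nonPos (proj₁ 0<x) x⁻¹≤0)))

  *-pos : ∀ {x y} → 0# < x → 0# < y → 0# < x * y
  *-pos {x} {y} 0<x 0<y = *-nonNeg (proj₁ 0<x) (proj₁ 0<y) , λ 0≈xy → 0<⇒≉0 0<y (begin-equality
    y               ≈⟨ *-identityˡ y ⟨
    1# * y          ≈⟨ *-congʳ (*-inverseˡ (0<⇒≉0 0<x)) ⟨
    (x ⁻¹ * x) * y  ≈⟨ *-assoc (x ⁻¹) x y ⟩
    x ⁻¹ * (x * y)  ≈⟨ *-congˡ 0≈xy ⟨
    x ⁻¹ * 0#       ≈⟨ zeroʳ (x ⁻¹) ⟩
    0#              ∎)

  ÷-nonNeg : ∀ {x y} → 0# ≤ x → 0# ≤ y → 0# ≤ x ÷ y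
  ÷-nonNeg {x} {y} 0≤x 0≤y with y ≟ 0#
  ... | yes _   = ≤-refl
  ... | no  y≉0 = *-nonNeg 0≤x (⁻¹-nonNeg (0≤∧≉0⇒0< 0≤y y≉0))

  x÷y≈x*1÷y : ∀ x y → x ÷ y ≈ x * (1# ÷ y)
  x÷y≈x*1÷y x y with y ≟ 0#
  ... | yes _ = sym (zeroʳ x)
  ... | no  _ = *-congˡ (sym (*-identityˡ _))

  y*[x÷y]≈x : ∀ {x y} → (y ≈ 0# → x ≈ 0#) → y * (x ÷ y) ≈ x
  y*[x÷y]≈x {x} {y} y≈0⇒x≈0 with y ≟ 0#
  ... | yes y≈0 = trans (zeroʳ y) (sym (y≈0⇒x≈0 y≈0))
  ... | no  y≉0 = begin-equality
    y * (x * y ⁻¹)  ≈⟨ solve 3 (λ x y z → y :* (x :* z) := x :* (y :* z)) refl x y (y ⁻¹) ⟩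
    x * (y * y ⁻¹)  ≈⟨ *-congˡ (*-inverseʳ y≉0) ⟩
    x * 1#          ≈⟨ *-identityʳ x ⟩
    x               ∎

  1÷x*x≈1 : ∀ {x} → 0# < x → (1# ÷ x) * x ≈ 1#
  1÷x*x≈1 0<x = trans (*-comm _ _) (y*[x÷y]≈x (λ x≈0 → ⊥-elim (0<⇒≉0 0<x x≈0)))

  min-÷*max : ∀ {e} s → 0# < e → min 1# ((1# ÷ e) * s) * max e s ≈ s
  min-÷*max {e} s 0<e with total e s
  ... | inj₁ e≤s = begin-equality
    min 1# ((1# ÷ e) * s) * max e s  ≈⟨ *-cong (x≤y⇒x⊓y≈x 1≤s/e) (x≤y⇒x⊔y≈y e≤s) ⟩
    1# * s                           ≈⟨ *-identityˡ s ⟩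
    s                                ∎
    where
    1≤s/e : 1# ≤ (1# ÷ e) * s
    1≤s/e = ≤-trans (≤-reflexive (sym (1÷x*x≈1 0<e))) (*-monoˡ-≤ (÷-nonNeg 0≤1 (proj₁ 0<e)) e≤s)
  ... | inj₂ s≤e = begin-equality
    min 1# ((1# ÷ e) * s) * max e s  ≈⟨ *-cong (x≤y⇒y⊓x≈x s/e≤1) (x≤y⇒y⊔x≈y s≤e) ⟩
    (1# ÷ e) * s * e                 ≈⟨ solve 3 (λ d s e → d :* s :* e := d :* e :* s) refl (1# ÷ e) s e ⟩
    (1# ÷ e) * e * s                 ≈⟨ *-congʳ (1÷x*x≈1 0<e) ⟩
    1# * s                           ≈⟨ *-identityˡ s ⟩
    s                                ∎
    where
    s/e≤1 : (1# ÷ e) * s ≤ 1#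
    s/e≤1 = ≤-trans (*-monoˡ-≤ (÷-nonNeg 0≤1 (proj₁ 0<e)) s≤e) (≤-reflexive (1÷x*x≈1 0<e))

  x≤∣x∣ : ∀ x → x ≤ ∣ x ∣
  x≤∣x∣ x = x≤x⊔y x (- x)

  -x≤∣x∣ : ∀ x → - x ≤ ∣ x ∣
  -x≤∣x∣ x = x≤y⊔x x (- x)

  0≤∣x∣ : ∀ x → 0# ≤ ∣ x ∣
  0≤∣x∣ x with total 0# x
  ... | inj₁ 0≤x = ≤-trans 0≤x (x≤∣x∣ x)
  ... | inj₂ x≤0 = ≤-trans (x≤0⇒0≤-x x≤0) (-x≤∣x∣ x)

  0≤x⇒∣x∣≈x : ∀ {x} → 0# ≤ x → ∣ x ∣ ≈ x
  0≤x⇒∣x∣≈x {x} 0≤x = antisym (⊔-lub ≤-refl (≤-trans -x≤0 0≤x)) (x≤∣x∣ x)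
    where
    -x≤0 : - x ≤ 0#
    -x≤0 = 0≤-x⇒x≤0 (≤-trans 0≤x (≤-reflexive (sym (-‿involutive x))))

  ∣x∣≈0 : ∀ {x} → x ≈ 0# → ∣ x ∣ ≈ 0#
  ∣x∣≈0 x≈0 = trans (0≤x⇒∣x∣≈x (≤-reflexive (sym x≈0))) x≈0

  fromℕ-nonNeg : ∀ k → 0# ≤ fromℕ k
  fromℕ-nonNeg zero    = ≤-refl
  fromℕ-nonNeg (suc k) = +-nonNeg 0≤1 (fromℕ-nonNeg k)

  1≤fromℕ-suc : ∀ k → 1# ≤ fromℕ (suc k)
  1≤fromℕ-suc k = x≤x+y 1# (fromℕ-nonNeg k)

  1+1 : Carrier
  1+1 = 1# + 1#

  0<1+1 : 0# < 1+1
  0<1+1 = 1≤⇒0< (x≤x+y 1# 0≤1)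

  half : Carrier → Carrier
  half x = x * 1+1 ⁻¹

  half+half≈x : ∀ x → half x + half x ≈ x
  half+half≈x x = begin-equality
    x * h + x * h        ≈⟨ solve 2 (λ x h → x :* h :+ x :* h := x :* (h :+ h)) refl x h ⟩
    x * (h + h)          ≈⟨ *-congˡ (+-cong (*-identityˡ h) (*-identityˡ h)) ⟨
    x * (1# * h + 1# * h) ≈⟨ *-congˡ (distribʳ h 1# 1#) ⟨
    x * (1+1 * h)        ≈⟨ *-congˡ (*-inverseʳ (0<⇒≉0 0<1+1)) ⟩
    x * 1#               ≈⟨ *-identityʳ x ⟩
    x                    ∎
    where
    h : Carrier
    h = 1+1 ⁻¹

  half-pos : ∀ {x} → 0# < x → 0# < half x
  half-pos {x} 0<x = *-nonNeg (proj₁ 0<x) (⁻¹-nonNeg 0<1+1) , λ 0≈h → 0<⇒≉0 0<x (begin-equality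
    x                ≈⟨ half+half≈x x ⟨
    half x + half x  ≈⟨ +-cong 0≈h 0≈h ⟨
    0# + 0#          ≈⟨ +-identityˡ 0# ⟩
    0#               ∎)

  +-cancelʳ-≤ : ∀ z {x y} → x + z ≤ y + z → x ≤ y
  +-cancelʳ-≤ z {x} {y} x+z≤y+z = begin
    x            ≈⟨ x+z-z≈x x ⟨
    x + z - z    ≤⟨ +-monoˡ-≤ (- z) x+z≤y+z ⟩
    y + z - z    ≈⟨ x+z-z≈x y ⟩
    y            ∎
    where
    x+z-z≈x : ∀ x → x + z - z ≈ x
    x+z-z≈x x = trans (+-assoc x z (- z)) (trans (+-congˡ (-‿inverseʳ z)) (+-identityʳ x))

  ≤-from-slack : ∀ {s t} → (∀ η → 0# < η → s ≤ t + (η + η)) → s ≤ t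
  ≤-from-slack {s} {t} s≤t+2η with total s t
  ... | inj₁ s≤t = s≤t
  ... | inj₂ t≤s with s ≟ t
  ...   | yes s≈t = ≤-reflexive s≈t
  ...   | no  s≉t = ⊥-elim (0<⇒≉0 0<d/2 (antisym d/2≤0 (proj₁ 0<d/2)))
    where
    d/2 : Carrier
    d/2 = half (s - t)
    0<d/2 : 0# < d/2
    0<d/2 = half-pos (0≤∧≉0⇒0< (x≤y⇒0≤y-x t≤s) λ s-t≈0 →
      s≉t (trans (sym (x-y+y≈x s t)) (trans (+-congʳ s-t≈0) (+-identityˡ t))))
    d/2≤0 : d/2 ≤ 0#
    d/2≤0 = +-cancelʳ-≤ (d/2 + t) (begin
      d/2 + (d/2 + t)                  ≈⟨ +-assoc d/2 d/2 t ⟨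
      (d/2 + d/2) + t                  ≈⟨ +-congʳ (half+half≈x (s - t)) ⟩
      (s - t) + t                      ≈⟨ x-y+y≈x s t ⟩
      s                                ≤⟨ s≤t+2η (half d/2) (half-pos 0<d/2) ⟩
      t + (half d/2 + half d/2)        ≈⟨ +-congˡ (half+half≈x d/2) ⟩
      t + d/2                          ≈⟨ +-comm t d/2 ⟩
      d/2 + t                          ≈⟨ +-identityˡ (d/2 + t) ⟨
      0# + (d/2 + t)                   ∎)

  ∣x-s∣≤η⇒x≤s+η : ∀ {x s η} → ∣ x - s ∣ ≤ η → x ≤ s + η
  ∣x-s∣≤η⇒x≤s+η {x} {s} {η} d≤η = begin
    x            ≈⟨ x-y+y≈x x s ⟨
    (x - s) + s  ≤⟨ +-monoˡ-≤ s (≤-trans (x≤∣x∣ (x - s)) d≤η) ⟩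
    η + s        ≈⟨ +-comm η s ⟩
    s + η        ∎

  ∣x-s∣≤η⇒s≤x+η : ∀ {x s η} → ∣ x - s ∣ ≤ η → s ≤ x + η
  ∣x-s∣≤η⇒s≤x+η {x} {s} {η} d≤η = begin
    s                    ≈⟨ +-identityʳ s ⟨
    s + 0#               ≈⟨ +-congˡ (-‿inverseʳ (x - s)) ⟨
    s + (x - s - (x - s)) ≈⟨ solve 3 (λ s d e → s :+ (d :+ e) := (d :+ s) :+ e) refl s (x - s) (- (x - s)) ⟩
    x - s + s - (x - s)  ≤⟨ +-mono-≤ (≤-reflexive (x-y+y≈x x s)) (≤-trans (-x≤∣x∣ (x - s)) d≤η) ⟩
    x + η                ∎

  partialSum : (ℕ → Carrier) → ℕ → Carrier
  partialSum f m = sum (λ (k : Fin m) → f (toℕ k))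

  HasSum-≤ : ∀ {s t} f g d → (∀ m → partialSum f m ≤ partialSum g (d ℕ.+ m)) →
             HasSum f s → HasSum g t → s ≤ t
  HasSum-≤ {s} {t} f g d f≤g ∑f≈s ∑g≈t = ≤-from-slack λ η 0<η →
    let M , near-s = ∑f≈s η 0<η
        N , near-t = ∑g≈t η 0<η
        m = M ℕ.+ N
    in begin
      s                              ≤⟨ ∣x-s∣≤η⇒s≤x+η (proj₁ (near-s m (ℕ.m≤m+n M N))) ⟩
      partialSum f m + η             ≤⟨ +-monoˡ-≤ η (f≤g m) ⟩
      partialSum g (d ℕ.+ m) + η     ≤⟨ +-monoˡ-≤ η (∣x-s∣≤η⇒x≤s+η (proj₁
                                          (near-t (d ℕ.+ m) (ℕ.≤-trans (ℕ.m≤n+m N M) (ℕ.m≤n+m m d))))) ⟩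
      (t + η) + η                    ≈⟨ +-assoc t η η ⟩
      t + (η + η)                    ∎

  HasSum-unique : ∀ {s t} f → HasSum f s → HasSum f t → s ≈ t
  HasSum-unique f ∑f≈s ∑f≈t =
    antisym (HasSum-≤ f f 0 (λ _ → ≤-refl) ∑f≈s ∑f≈t) (HasSum-≤ f f 0 (λ _ → ≤-refl) ∑f≈t ∑f≈s)

  HasSum-0 : HasSum (λ _ → 0#) 0#
  HasSum-0 η 0<η = 0 , λ m _ →
    let d≈0 = ∣x∣≈0 (trans (+-congʳ (sum-replicate-zero m)) (-‿inverseʳ 0#))
    in ≤-trans (≤-reflexive d≈0) (proj₁ 0<η) , λ d≈η → proj₂ 0<η (trans (sym d≈0) d≈η)

  sum-mono-≤ : ∀ {n} {f g : Vector n} → (∀ i → f i ≤ g i) → sum f ≤ sum g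
  sum-mono-≤ {zero}  f≤g = ≤-refl
  sum-mono-≤ {suc n} f≤g = +-mono-≤ (f≤g zero) (sum-mono-≤ (f≤g ∘ suc))

  sum-nonNeg : ∀ {n} {f : Vector n} → (∀ i → 0# ≤ f i) → 0# ≤ sum f
  sum-nonNeg {n} 0≤f = ≤-trans (≤-reflexive (sym (sum-replicate-zero n))) (sum-mono-≤ 0≤f)

  HasSum-nonNeg : ∀ {s} f → (∀ k → 0# ≤ f k) → HasSum f s → 0# ≤ s
  HasSum-nonNeg f 0≤f = HasSum-≤ (λ _ → 0#) f 0 (λ m → sum-mono-≤ {m} (λ k → 0≤f (toℕ k))) HasSum-0

  infix 7 _∙_
  _∙_ : ∀ {n} → Vector n → Vector n → Carrier
  f ∙ g = sum (λ v → f v * g v)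

  ∑ₗ : ∀ {a} {A : Set a} → List A → (A → Carrier) → Carrier
  ∑ₗ []       f = 0#
  ∑ₗ (x ∷ xs) f = f x + ∑ₗ xs f

  module _ {a} {A : Set a} where

    ∑ₗ-cong : ∀ (xs : List A) {f g} → (∀ x → f x ≈ g x) → ∑ₗ xs f ≈ ∑ₗ xs g
    ∑ₗ-cong []       f≈g = refl
    ∑ₗ-cong (x ∷ xs) f≈g = +-cong (f≈g x) (∑ₗ-cong xs f≈g)

    ∑ₗ-mono-≤ : ∀ {xs : List A} {f g} → All (λ x → f x ≤ g x) xs → ∑ₗ xs f ≤ ∑ₗ xs g
    ∑ₗ-mono-≤ []            = ≤-refl
    ∑ₗ-mono-≤ (f≤g ∷ fs≤gs) = +-mono-≤ f≤g (∑ₗ-mono-≤ fs≤gs)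

    ∑ₗ-+ : ∀ (xs : List A) f g → ∑ₗ xs (λ x → f x + g x) ≈ ∑ₗ xs f + ∑ₗ xs g
    ∑ₗ-+ []       f g = sym (+-identityˡ 0#)
    ∑ₗ-+ (x ∷ xs) f g = trans (+-congˡ (∑ₗ-+ xs f g))
      (solve 4 (λ a b c d → (a :+ b) :+ (c :+ d) := (a :+ c) :+ (b :+ d))
        refl (f x) (g x) (∑ₗ xs f) (∑ₗ xs g))

    ∑ₗ-*ˡ : ∀ (xs : List A) z f → ∑ₗ xs (λ x → z * f x) ≈ z * ∑ₗ xs f
    ∑ₗ-*ˡ []       z f = sym (zeroʳ z)
    ∑ₗ-*ˡ (x ∷ xs) z f = trans (+-congˡ (∑ₗ-*ˡ xs z f)) (sym (distribˡ z (f x) (∑ₗ xs f)))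

    ∑ₗ-const : ∀ (xs : List A) z → ∑ₗ xs (λ _ → z) ≈ z * fromℕ (length xs)
    ∑ₗ-const []       z = sym (zeroʳ z)
    ∑ₗ-const (x ∷ xs) z =
      trans (+-cong (sym (*-identityʳ z)) (∑ₗ-const xs z)) (sym (distribˡ z 1# (fromℕ (length xs))))

    ∑ₗ-filter : ∀ {p} {P : Pred A p} (P? : Decidable P) xs f →
                ∑ₗ (filter P? xs) f ≈ ∑ₗ xs (λ x → if does (P? x) then f x else 0#)
    ∑ₗ-filter P? []       f = refl
    ∑ₗ-filter P? (x ∷ xs) f with does (P? x)
    ... | true  = +-congˡ (∑ₗ-filter P? xs f)
    ... | false = trans (∑ₗ-filter P? xs f) (sym (+-identityˡ _))

    ∑ₗ-tabulate : ∀ {n} (h : Fin n → A) f → ∑ₗ (tabulate h) f ≈ sum (f ∘ h)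
    ∑ₗ-tabulate {zero}  h f = refl
    ∑ₗ-tabulate {suc n} h f = +-congˡ (∑ₗ-tabulate (h ∘ suc) f)

  ∑ₗ-filter-allFin : ∀ {n p} {P : Pred (Fin n) p} (P? : Decidable P) f →
                     ∑ₗ (filter P? (allFin n)) f ≈ sum (λ v → if does (P? v) then f v else 0#)
  ∑ₗ-filter-allFin P? f =
    trans (∑ₗ-filter P? (allFin _) f) (∑ₗ-tabulate (λ v → v) (λ v → if does (P? v) then f v else 0#))

  *ₘ-*ᵥ-assoc : ∀ {n} (M N : Matrix n) (z : Vector n) v → ((M *ₘ N) *ᵥ z) v ≈ (M *ᵥ (N *ᵥ z)) v
  *ₘ-*ᵥ-assoc M N z v = begin-equality
    sum (λ u → sum (λ k → M v k * N k u) * z u)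
      ≈⟨ sum-cong-≋ (λ u → *-distribʳ-sum (z u) (λ k → M v k * N k u)) ⟩
    sum (λ u → sum (λ k → M v k * N k u * z u))
      ≈⟨ ∑-comm (λ u k → M v k * N k u * z u) ⟩
    sum (λ k → sum (λ u → M v k * N k u * z u))
      ≈⟨ sum-cong-≋ (λ k → sum-cong-≋ (λ u → *-assoc (M v k) (N k u) (z u))) ⟩
    sum (λ k → sum (λ u → M v k * (N k u * z u)))
      ≈⟨ sum-cong-≋ (λ k → *-distribˡ-sum (M v k) (λ u → N k u * z u)) ⟨
    sum (λ k → M v k * sum (λ u → N k u * z u))
      ∎

  sum-indicator : ∀ {n} (u : Fin n) (z : Vector n) →
                  sum (λ v → (if does (u Fin.≟ v) then 1# else 0#) * z v) ≈ z u
  sum-indicator {suc n} zero z = begin-equality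
    1# * z zero + sum (λ v → 0# * z (suc v))  ≈⟨ +-cong (*-identityˡ (z zero)) (sum-cong-≋ (λ v → zeroˡ (z (suc v)))) ⟩
    z zero + sum {n} (λ _ → 0#)               ≈⟨ +-congˡ (sum-replicate-zero n) ⟩
    z zero + 0#                               ≈⟨ +-identityʳ (z zero) ⟩
    z zero                                    ∎
  sum-indicator {suc n} (suc u) z = begin-equality
    0# * z zero + sum (λ v → (if does (u Fin.≟ v) then 1# else 0#) * z (suc v))
                      ≈⟨ +-cong (zeroˡ (z zero)) (sum-indicator u (z ∘ suc)) ⟩
    0# + z (suc u)    ≈⟨ +-identityˡ (z (suc u)) ⟩
    z (suc u)         ∎

  sum-indicatorʳ : ∀ {n} (u : Fin n) (z : Vector n) →
                   sum (λ v → (if does (v Fin.≟ u) then 1# else 0#) * z v) ≈ z u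
  sum-indicatorʳ {n} u z = trans (sum-cong-≋ {n} λ v → *-congʳ (flip v)) (sum-indicator u z)
    where
    flip : ∀ v → (if does (v Fin.≟ u) then 1# else 0#) ≈ (if does (u Fin.≟ v) then 1# else 0#)
    flip v with v Fin.≟ u | u Fin.≟ v
    ... | yes _   | yes _   = refl
    ... | no  _   | no  _   = refl
    ... | yes v≡u | no  u≢v = ⊥-elim (u≢v (≡.sym v≡u))
    ... | no  v≢u | yes u≡v = ⊥-elim (v≢u (≡.sym u≡v))

  ∙-update : ∀ {n} (η r : Vector n) u z →
             η ∙ (λ v → if does (v Fin.≟ u) then r v + z else r v) ≈ η ∙ r + η u * z
  ∙-update {n} η r u z = begin-equality
    sum (λ v → η v * (if does (v Fin.≟ u) then r v + z else r v))
      ≈⟨ sum-cong-≋ {n} split ⟩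
    sum (λ v → η v * r v + (if does (v Fin.≟ u) then 1# else 0#) * (η v * z))
      ≈⟨ ∑-distrib-+ {n} _ _ ⟩
    η ∙ r + sum (λ v → (if does (v Fin.≟ u) then 1# else 0#) * (η v * z))
      ≈⟨ +-congˡ (sum-indicatorʳ u (λ v → η v * z)) ⟩
    η ∙ r + η u * z
      ∎
    where
    split : ∀ v → η v * (if does (v Fin.≟ u) then r v + z else r v) ≈
                  η v * r v + (if does (v Fin.≟ u) then 1# else 0#) * (η v * z)
    split v with does (v Fin.≟ u)
    ... | true  = trans (distribˡ (η v) (r v) z) (+-congˡ (sym (*-identityˡ (η v * z))))
    ... | false = sym (trans (+-congˡ (zeroˡ (η v * z))) (+-identityʳ (η v * r v)))

module DistributionProperties {c ℓ₁ ℓ₂} (R : RealNumbers c ℓ₁ ℓ₂) where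

  open RealNumbers R
  open RealProperties R
  open Propagation R
  open PosetReasoning poset

  NonNegative : ∀ {ℓ} {A : Set ℓ} → Dist A → Set _
  NonNegative = All (λ pz → 0# ≤ proj₁ pz)

  module _ {ℓ} {A : Set ℓ} where

    𝔼-return : ∀ (z : A) f → 𝔼 (return z) f ≈ f z
    𝔼-return z f = trans (+-identityʳ (1# * f z)) (*-identityˡ (f z))

    return-nonNegative : ∀ (z : A) → NonNegative (return z)
    return-nonNegative z = 0≤1 ∷ []

    𝔼-cong : ∀ (d : Dist A) {f g} → (∀ z → f z ≈ g z) → 𝔼 d f ≈ 𝔼 d g
    𝔼-cong []            f≈g = refl
    𝔼-cong ((p , z) ∷ d) f≈g = +-cong (*-congˡ (f≈g z)) (𝔼-cong d f≈g)

    𝔼-mono-≤ : ∀ {d : Dist A} {f g} → NonNegative d → (∀ z → f z ≤ g z) → 𝔼 d f ≤ 𝔼 d g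
    𝔼-mono-≤ []                   f≤g = ≤-refl
    𝔼-mono-≤ {(_ , z) ∷ _} (0≤p ∷ 0≤d) f≤g = +-mono-≤ (*-monoˡ-≤ 0≤p (f≤g z)) (𝔼-mono-≤ 0≤d f≤g)

    𝔼-+ : ∀ (d : Dist A) f g → 𝔼 d (λ z → f z + g z) ≈ 𝔼 d f + 𝔼 d g
    𝔼-+ []            f g = sym (+-identityˡ 0#)
    𝔼-+ ((p , z) ∷ d) f g = trans (+-congˡ (𝔼-+ d f g))
      (solve 5 (λ p x y s t → p :* (x :+ y) :+ (s :+ t) := (p :* x :+ s) :+ (p :* y :+ t))
        refl p (f z) (g z) (𝔼 d f) (𝔼 d g))

    𝔼-++ : ∀ (d d′ : Dist A) f → 𝔼 (d List.++ d′) f ≈ 𝔼 d f + 𝔼 d′ f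
    𝔼-++ []            d′ f = sym (+-identityˡ (𝔼 d′ f))
    𝔼-++ ((p , z) ∷ d) d′ f = trans (+-congˡ (𝔼-++ d d′ f)) (sym (+-assoc (p * f z) (𝔼 d f) (𝔼 d′ f)))

    𝔼-scale : ∀ p (d : Dist A) f → 𝔼 (List.map (λ (q , z) → (p * q , z)) d) f ≈ p * 𝔼 d f
    𝔼-scale p []            f = sym (zeroʳ p)
    𝔼-scale p ((q , z) ∷ d) f = trans (+-congˡ (𝔼-scale p d f))
      (solve 4 (λ p q x s → p :* q :* x :+ p :* s := p :* (q :* x :+ s)) refl p q (f z) (𝔼 d f))

  module _ {ℓ ℓ′} {A : Set ℓ} {B : Set ℓ′} where

    𝔼->>= : ∀ (d : Dist A) (f : A → Dist B) g → 𝔼 (d >>= f) g ≈ 𝔼 d (λ z → 𝔼 (f z) g)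
    𝔼->>= []            f g = refl
    𝔼->>= ((p , z) ∷ d) f g =
      trans (𝔼-++ (List.map (λ (q , y) → (p * q , y)) (f z)) (d >>= f) g)
            (+-cong (𝔼-scale p (f z) g) (𝔼->>= d f g))

    >>=-nonNegative : ∀ {d : Dist A} {f : A → Dist B} →
                      NonNegative d → (∀ z → NonNegative (f z)) → NonNegative (d >>= f)
    >>=-nonNegative []                            0≤f = []
    >>=-nonNegative {(_ , z) ∷ _} (0≤p ∷ 0≤d) 0≤f =
      All.++⁺ (All.map⁺ (All.map (*-nonNeg 0≤p) (0≤f z))) (>>=-nonNegative 0≤d 0≤f)

  module _ {n} (p : Fin n → Carrier) where

    sampleSubset-nonNegative : ∀ {vs} → All (λ v → (0# ≤ p v) × (p v ≤ 1#)) vs →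
                               NonNegative (sampleSubset p vs)
    sampleSubset-nonNegative []                   = 0≤1 ∷ []
    sampleSubset-nonNegative {v ∷ _} ((0≤p , p≤1) ∷ 0≤ps) =
      >>=-nonNegative (0≤p ∷ x≤y⇒0≤y-x p≤1 ∷ []) λ selected →
        >>=-nonNegative (sampleSubset-nonNegative 0≤ps) λ S →
          return-nonNegative (if selected then v ∷ S else S)

    𝔼-sampleSubset : ∀ vs k f →
      𝔼 (sampleSubset p vs) (λ S → k + ∑ₗ S f) ≈ k + ∑ₗ vs (λ v → p v * f v)
    𝔼-sampleSubset []       k f = 𝔼-return [] (λ S → k + ∑ₗ S f)
    𝔼-sampleSubset (v ∷ vs) k f = begin-equality
      𝔼 (sampleSubset p (v ∷ vs)) g
        ≈⟨ 𝔼->>= (bernoulli (p v)) (λ selected → sampleSubset p vs >>= branch selected) g ⟩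
      p v * 𝔼 (sampleSubset p vs >>= branch true) g +
        ((1# - p v) * 𝔼 (sampleSubset p vs >>= branch false) g + 0#)
        ≈⟨ +-cong (*-congˡ selected-true) (+-congʳ (*-congˡ selected-false)) ⟩
      p v * ((k + f v) + T) + ((1# - p v) * (k + T) + 0#)
        ≈⟨ solve 5 (λ p q k x t → p :* ((k :+ x) :+ t) :+ (q :* (k :+ t) :+ con 0) :=
                                  (q :+ p) :* (k :+ t) :+ p :* x) refl (p v) (1# - p v) k (f v) T ⟩
      ((1# - p v) + p v) * (k + T) + p v * f v
        ≈⟨ +-congʳ (trans (*-congʳ (x-y+y≈x 1# (p v))) (*-identityˡ (k + T))) ⟩
      (k + T) + p v * f v
        ≈⟨ solve 3 (λ k t y → (k :+ t) :+ y := k :+ (y :+ t)) refl k T (p v * f v) ⟩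
      k + (p v * f v + T)
        ∎
      where
      g : List (Fin n) → Carrier
      g S = k + ∑ₗ S f
      T : Carrier
      T = ∑ₗ vs (λ v → p v * f v)
      branch : Bool → List (Fin n) → Dist (List (Fin n))
      branch selected S = return (if selected then v ∷ S else S)
      selected-true : 𝔼 (sampleSubset p vs >>= branch true) g ≈ (k + f v) + T
      selected-true = begin-equality
        𝔼 (sampleSubset p vs >>= branch true) g                 ≈⟨ 𝔼->>= (sampleSubset p vs) (branch true) g ⟩
        𝔼 (sampleSubset p vs) (λ S → 𝔼 (return (v ∷ S)) g)      ≈⟨ 𝔼-cong (sampleSubset p vs) (λ S → trans (𝔼-return (v ∷ S) g)
                                                                     (sym (+-assoc k (f v) (∑ₗ S f)))) ⟩
        𝔼 (sampleSubset p vs) (λ S → (k + f v) + ∑ₗ S f)        ≈⟨ 𝔼-sampleSubset vs (k + f v) f ⟩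
        (k + f v) + T                                           ∎
      selected-false : 𝔼 (sampleSubset p vs >>= branch false) g ≈ k + T
      selected-false = begin-equality
        𝔼 (sampleSubset p vs >>= branch false) g      ≈⟨ 𝔼->>= (sampleSubset p vs) (branch false) g ⟩
        𝔼 (sampleSubset p vs) (λ S → 𝔼 (return S) g)  ≈⟨ 𝔼-cong (sampleSubset p vs) (λ S → 𝔼-return S g) ⟩
        𝔼 (sampleSubset p vs) g                       ≈⟨ 𝔼-sampleSubset vs k f ⟩
        k + T                                         ∎

module Analysis {c ℓ₁ ℓ₂} (R : RealNumbers c ℓ₁ ℓ₂) (alg : Propagation.AGPAlgorithm R)
                {n : ℕ} (G : Graph n) (q : Propagation.Query R n) where

  open RealNumbers R
  open RealProperties R
  open Propagation R
  open DistributionProperties R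
  open AGPAlgorithm alg
  open Query q
  open Graph G using (Edge; edge?; neighbours; degree) renaming (sym to Edge-sym)
  open PosetReasoning poset

  private
    e : Carrier
    e = ε G q

    0<e : 0# < e
    0<e = 0<ε G q

    cₒ : Carrier
    cₒ = cₛₒ G

    0≤cₒ : 0# ≤ cₒ
    0≤cₒ = ≤-trans 0≤1 (1≤cₛₒ G)

  0≤1÷e : 0# ≤ 1# ÷ e
  0≤1÷e = ÷-nonNeg 0≤1 (proj₁ 0<e)

  A : Carrier
  A = K + B

  0≤A : 0# ≤ A
  0≤A = +-nonNeg 0≤K 0≤B

  H : Carrier
  H = A * (cₒ * (1# ÷ e))

  Y-nonNeg : ∀ i → 0# ≤ Y i
  Y-nonNeg i = HasSum-nonNeg (λ k → w (i ℕ.+ k)) (λ k → 0≤w (i ℕ.+ k)) (Y-sum i)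

  Y0≈1 : Y 0 ≈ 1#
  Y0≈1 = HasSum-unique w (Y-sum 0) ∑w≈1

  Y-decreasing : ∀ i → Y (suc i) ≤ Y i
  Y-decreasing i = HasSum-≤ f g 1 shift (Y-sum (suc i)) (Y-sum i)
    where
    f g : ℕ → Carrier
    f k = w (suc i ℕ.+ k)
    g k = w (i ℕ.+ k)
    shift : ∀ m → partialSum f m ≤ partialSum g (suc m)
    shift m = begin
      partialSum f m                  ≈⟨ sum-cong-≋ {m} (λ k → reflexive (≡.cong w (≡.sym (ℕ.+-suc i (toℕ k))))) ⟩
      partialSum (λ k → g (suc k)) m  ≤⟨ x≤y+x _ (0≤w (i ℕ.+ 0)) ⟩
      partialSum g (suc m)            ∎

  ratio : ℕ → Carrier
  ratio i = Y (suc i) ÷ Y i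

  Y*ratio : ∀ i → Y i * ratio i ≈ Y (suc i)
  Y*ratio i = y*[x÷y]≈x λ Yi≈0 →
    antisym (≤-trans (Y-decreasing i) (≤-reflexive Yi≈0)) (Y-nonNeg (suc i))

  M : Matrix n
  M = propagationMatrix G a b

  weight : Fin n → Fin n → Carrier
  weight v u = (fromℕ (degree v) ^ʳ a) * (fromℕ (degree u) ^ʳ b)

  degree-pos : ∀ {u v} → Edge u v → 0# < fromℕ (degree u)
  degree-pos {u} {v} uv with neighbours u | ∈-filter⁺ (edge? u) (∈-allFin v) uv
  ... | _ ∷ vs | _ = 1≤⇒0< (1≤fromℕ-suc (length vs))

  weight-pos : ∀ {u v} → Edge u v → 0# < weight v u
  weight-pos uv = *-pos (^ʳ-pos a (degree-pos (Edge-sym uv))) (^ʳ-pos b (degree-pos uv))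

  ratio-nonNeg : ∀ i → 0# ≤ ratio i
  ratio-nonNeg i = ÷-nonNeg (Y-nonNeg (suc i)) (Y-nonNeg i)

  ∑-share : ∀ i u ρ (h : Vector n) →
    ∑ₗ (neighbours u) (λ v → h v * Step.share G q e i u ρ v) ≈
    ρ * (ratio i * sum (λ v → h v * M v u))
  ∑-share i u ρ h = begin-equality
    ∑ₗ (neighbours u) (λ v → h v * (ratio i * (ρ ÷ weight v u)))
      ≈⟨ ∑ₗ-filter-allFin (edge? u) (λ v → h v * (ratio i * (ρ ÷ weight v u))) ⟩
    sum (λ v → if does (edge? u v) then h v * (ratio i * (ρ ÷ weight v u)) else 0#)
      ≈⟨ sum-cong-≋ {n} entry ⟩
    sum (λ v → (ρ * ratio i) * (h v * M v u))
      ≈⟨ *-distribˡ-sum {n} (ρ * ratio i) (λ v → h v * M v u) ⟨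
    (ρ * ratio i) * sum (λ v → h v * M v u)
      ≈⟨ *-assoc ρ (ratio i) _ ⟩
    ρ * (ratio i * sum (λ v → h v * M v u))
      ∎
    where
    entry : ∀ v → (if does (edge? u v) then h v * (ratio i * (ρ ÷ weight v u)) else 0#) ≈
                  (ρ * ratio i) * (h v * M v u)
    entry v with does (edge? u v)
    ... | true  = trans (*-congˡ (*-congˡ (x÷y≈x*1÷y ρ (weight v u))))
      (solve 4 (λ x y z t → x :* (y :* (z :* t)) := (z :* y) :* (x :* t))
        refl (h v) (ratio i) ρ (1# ÷ weight v u))
    ... | false = sym (trans (*-congˡ (zeroʳ (h v))) (zeroʳ (ρ * ratio i)))

  -- Entries of r̂⁽ⁱ⁾ for i ≥ 1 are sums of increments, each at least ε.
  Thresholded : Vector n → Set _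
  Thresholded r = ∀ v → (r v ≈ 0#) ⊎ (e ≤ r v)

  thresholded-nonNeg : ∀ {r} → Thresholded r → ∀ v → 0# ≤ r v
  thresholded-nonNeg r-thr v with r-thr v
  ... | inj₁ r≈0 = ≤-reflexive (sym r≈0)
  ... | inj₂ e≤r = ≤-trans (proj₁ 0<e) e≤r

  length-support : ∀ (r : Vector n) → fromℕ (length (support r)) ≈ sum (λ v → if does (¬? (r v ≟ 0#)) then 1# else 0#)
  length-support r = begin-equality
    fromℕ (length (support r))       ≈⟨ *-identityˡ _ ⟨
    1# * fromℕ (length (support r))  ≈⟨ ∑ₗ-const (support r) 1# ⟨
    ∑ₗ (support r) (λ _ → 1#)        ≈⟨ ∑ₗ-filter-allFin (λ v → ¬? (r v ≟ 0#)) (λ _ → 1#) ⟩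
    sum (λ v → if does (¬? (r v ≟ 0#)) then 1# else 0#) ∎

  ∑-support : ∀ (r h : Vector n) → ∑ₗ (support r) (λ u → r u * h u) ≈ h ∙ r
  ∑-support r h = trans
    (∑ₗ-filter-allFin (λ v → ¬? (r v ≟ 0#)) (λ u → r u * h u))
    (sum-cong-≋ {n} entry)
    where
    entry : ∀ u → (if does (¬? (r u ≟ 0#)) then r u * h u else 0#) ≈ h u * r u
    entry u with r u ≟ 0#
    ... | yes r≈0 = sym (trans (*-congˡ r≈0) (zeroʳ (h u)))
    ... | no  _   = *-comm (r u) (h u)

  length-support-≤ : ∀ {r} → Thresholded r → fromℕ (length (support r)) ≤ (1# ÷ e) * sum r
  length-support-≤ {r} r-thr = begin
    fromℕ (length (support r))                           ≈⟨ length-support r ⟩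
    sum (λ v → if does (¬? (r v ≟ 0#)) then 1# else 0#)  ≤⟨ sum-mono-≤ entry ⟩
    sum (λ v → (1# ÷ e) * r v)                           ≈⟨ *-distribˡ-sum (1# ÷ e) r ⟨
    (1# ÷ e) * sum r                                     ∎
    where
    entry : ∀ v → (if does (¬? (r v ≟ 0#)) then 1# else 0#) ≤ (1# ÷ e) * r v
    entry v with r v ≟ 0# | r-thr v
    ... | yes _   | _        = *-nonNeg 0≤1÷e (thresholded-nonNeg r-thr v)
    ... | no  r≉0 | inj₁ r≈0 = ⊥-elim (r≉0 r≈0)
    ... | no  _   | inj₂ e≤r = ≤-trans (≤-reflexive (sym (1÷x*x≈1 0<e))) (*-monoˡ-≤ 0≤1÷e e≤r)

  charge : ℕ → Vector n → Fin n → Carrier → Carrier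
  charge i η u ρ = A * cₒ + ∑ₗ (neighbours u) (λ v → (H + η v) * Step.share G q e i u ρ v)

  module _ (i : ℕ) (u : Fin n) (ρ : Carrier) where
    open Step G q e i u ρ

    push-thresholded : ∀ S {r} → Thresholded r → Thresholded (push S r)
    push-thresholded []      r-thr = r-thr
    push-thresholded (v ∷ S) {r} r-thr = push-thresholded S updated
      where
      updated : Thresholded (λ v′ → if does (v′ Fin.≟ v) then r v′ + increment v else r v′)
      updated v′ with does (v′ Fin.≟ v)
      ... | true  = inj₂ (≤-trans (x≤x⊔y e (share v)) (x≤y+x (increment v) (thresholded-nonNeg r-thr v′)))
      ... | false = r-thr v′

    ∙-push : ∀ η S r → η ∙ push S r ≈ η ∙ r + ∑ₗ S (λ v → η v * increment v)
    ∙-push η []      r = sym (+-identityʳ (η ∙ r))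
    ∙-push η (v ∷ S) r = begin-equality
      η ∙ push (v ∷ S) r
        ≈⟨ ∙-push η S _ ⟩
      η ∙ (λ v′ → if does (v′ Fin.≟ v) then r v′ + increment v else r v′) + T
        ≈⟨ +-congʳ (∙-update η r v (increment v)) ⟩
      η ∙ r + η v * increment v + T
        ≈⟨ +-assoc (η ∙ r) (η v * increment v) T ⟩
      η ∙ r + (η v * increment v + T)
        ∎
      where
      T : Carrier
      T = ∑ₗ S (λ v′ → η v′ * increment v′)

    μ≈∑probability : μ ≈ ∑ₗ (neighbours u) probability
    μ≈∑probability = begin-equality
      𝔼 selection (λ S → fromℕ (length S))
        ≈⟨ 𝔼-cong selection (λ S → sym (trans (+-identityˡ _) (trans (∑ₗ-const S 1#) (*-identityˡ _)))) ⟩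
      𝔼 selection (λ S → 0# + ∑ₗ S (λ _ → 1#))
        ≈⟨ 𝔼-sampleSubset probability (neighbours u) 0# (λ _ → 1#) ⟩
      0# + ∑ₗ (neighbours u) (λ v → probability v * 1#)
        ≈⟨ trans (+-identityˡ _) (∑ₗ-cong (neighbours u) (λ v → *-identityʳ (probability v))) ⟩
      ∑ₗ (neighbours u) probability
        ∎

    module _ (0<ρ : 0# < ρ) where

      share-nonNeg : ∀ {v} → Edge u v → 0# ≤ share v
      share-nonNeg uv = *-nonNeg (ratio-nonNeg i) (÷-nonNeg (proj₁ 0<ρ) (proj₁ (weight-pos uv)))

      selection-nonNegative : NonNegative selection
      selection-nonNegative = sampleSubset-nonNegative probability
        (All.map (λ uv → ⊓-glb 0≤1 (*-nonNeg 0≤1÷e (share-nonNeg uv)) , x⊓y≤x 1# _)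
                 (All.all-filter (edge? u) (allFin n)))

      push-charge : ∀ (η : Vector n) {v} → Edge u v →
        K * probability v + probability v * (B + η v * increment v) ≤ (H + η v) * share v
      push-charge η {v} uv = begin
        K * p + p * (B + η v * increment v)
          ≈⟨ solve 5 (λ k p b h x → k :* p :+ p :* (b :+ h :* x) := (k :+ b) :* p :+ h :* (p :* x))
               refl K p B (η v) (increment v) ⟩
        A * p + η v * (p * increment v)
          ≈⟨ +-congˡ (*-congˡ (min-÷*max (share v) 0<e)) ⟩
        A * p + η v * share v
          ≤⟨ +-monoˡ-≤ (η v * share v) (*-monoˡ-≤ 0≤A p≤) ⟩
        A * (cₒ * ((1# ÷ e) * share v)) + η v * share v
          ≈⟨ solve 5 (λ a c d s h → a :* (c :* (d :* s)) :+ h :* s := (a :* (c :* d) :+ h) :* s)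
               refl A cₒ (1# ÷ e) (share v) (η v) ⟩
        (H + η v) * share v
          ∎
        where
        p : Carrier
        p = probability v
        p≤ : p ≤ cₒ * ((1# ÷ e) * share v)
        p≤ = begin
          p                           ≤⟨ x⊓y≤y 1# _ ⟩
          (1# ÷ e) * share v          ≈⟨ *-identityˡ _ ⟨
          1# * ((1# ÷ e) * share v)   ≤⟨ *-monoʳ-≤ (*-nonNeg 0≤1÷e (share-nonNeg uv)) (1≤cₛₒ G) ⟩
          cₒ * ((1# ÷ e) * share v)   ∎

      step-bound : i ℕ.< L → ∀ η r t z →
        𝔼 selection (λ S → ((t + (sampleTime G q i u ρ S + B * (1# + fromℕ (length S)))) + η ∙ push S r) + z)
          ≤ (t + η ∙ r) + (charge i η u ρ + z)
      step-bound i<L η r t z = begin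
        𝔼 selection (λ S → ((t + (τ S + B * (1# + fromℕ (length S)))) + η ∙ push S r) + z)
          ≈⟨ 𝔼-cong selection regroup ⟩
        𝔼 selection (λ S → τ S + (k + ∑ₗ S f))
          ≈⟨ 𝔼-+ selection τ (λ S → k + ∑ₗ S f) ⟩
        𝔼 selection τ + 𝔼 selection (λ S → k + ∑ₗ S f)
          ≤⟨ +-mono-≤ (sampleTime-bound G q i u ρ i<L 0<ρ)
                      (≤-reflexive (𝔼-sampleSubset probability N k f)) ⟩
        K * (μ + cₒ) + (k + ∑ₗ N (λ v → probability v * f v))
          ≈⟨ +-congʳ (*-congˡ (+-congʳ μ≈∑probability)) ⟩
        K * (∑ₗ N probability + cₒ) + (k + ∑ₗ N (λ v → probability v * f v))
          ≈⟨ solve 8 (λ K m c t B h z s → K :* (m :+ c) :+ (((t :+ B) :+ (h :+ z)) :+ s) :=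
                        (t :+ h) :+ (((K :* c :+ B) :+ (K :* m :+ s)) :+ z))
               refl K (∑ₗ N probability) cₒ t B (η ∙ r) z (∑ₗ N (λ v → probability v * f v)) ⟩
        (t + η ∙ r) + (((K * cₒ + B) + (K * ∑ₗ N probability + ∑ₗ N (λ v → probability v * f v))) + z)
          ≤⟨ +-monoʳ-≤ _ (+-monoˡ-≤ z (+-mono-≤ overhead pushes)) ⟩
        (t + η ∙ r) + (charge i η u ρ + z)
          ∎
        where
        N : List (Fin n)
        N = neighbours u
        τ : List (Fin n) → Carrier
        τ = sampleTime G q i u ρ
        f : Fin n → Carrier
        f v = B + η v * increment v
        k : Carrier
        k = (t + B) + (η ∙ r + z)
        regroup : ∀ S → ((t + (τ S + B * (1# + fromℕ (length S)))) + η ∙ push S r) + z ≈ τ S + (k + ∑ₗ S f)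
        regroup S = begin-equality
          ((t + (τ S + B * (1# + fromℕ (length S)))) + η ∙ push S r) + z
            ≈⟨ +-congʳ (+-congˡ (∙-push η S r)) ⟩
          ((t + (τ S + B * (1# + fromℕ (length S)))) + (η ∙ r + ∑ₗ S (λ v → η v * increment v))) + z
            ≈⟨ solve 7 (λ t τ B l h s z → ((t :+ (τ :+ B :* (con 1 :+ l))) :+ (h :+ s)) :+ z :=
                          τ :+ (((t :+ B) :+ (h :+ z)) :+ (B :* l :+ s)))
                 refl t (τ S) B (fromℕ (length S)) (η ∙ r) (∑ₗ S (λ v → η v * increment v)) z ⟩
          τ S + (k + (B * fromℕ (length S) + ∑ₗ S (λ v → η v * increment v)))
            ≈⟨ +-congˡ (+-congˡ (+-congʳ (∑ₗ-const S B))) ⟨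
          τ S + (k + (∑ₗ S (λ _ → B) + ∑ₗ S (λ v → η v * increment v)))
            ≈⟨ +-congˡ (+-congˡ (∑ₗ-+ S (λ _ → B) (λ v → η v * increment v))) ⟨
          τ S + (k + ∑ₗ S f)
            ∎
        overhead : K * cₒ + B ≤ A * cₒ
        overhead = begin
          K * cₒ + B       ≈⟨ +-congˡ (*-identityʳ B) ⟨
          K * cₒ + B * 1#  ≤⟨ +-monoʳ-≤ (K * cₒ) (*-monoˡ-≤ 0≤B (1≤cₛₒ G)) ⟩
          K * cₒ + B * cₒ  ≈⟨ distribʳ cₒ K B ⟨
          A * cₒ           ∎
        pushes : K * ∑ₗ N probability + ∑ₗ N (λ v → probability v * f v) ≤ ∑ₗ N (λ v → (H + η v) * share v)
        pushes = begin
          K * ∑ₗ N probability + ∑ₗ N (λ v → probability v * f v)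
            ≈⟨ +-congʳ (∑ₗ-*ˡ N K probability) ⟨
          ∑ₗ N (λ v → K * probability v) + ∑ₗ N (λ v → probability v * f v)
            ≈⟨ ∑ₗ-+ N (λ v → K * probability v) (λ v → probability v * f v) ⟨
          ∑ₗ N (λ v → K * probability v + probability v * f v)
            ≤⟨ ∑ₗ-mono-≤ (All.map (push-charge η) (All.all-filter (edge? u) (allFin n))) ⟩
          ∑ₗ N (λ v → (H + η v) * share v)
            ∎

  processLevel-bound : ∀ i → i ℕ.< L → ∀ r (f : Vector n × Carrier → Carrier) η →
    (∀ r⁺ t → Thresholded r⁺ → f (r⁺ , t) ≤ t + η ∙ r⁺) →
    ∀ {us} → All (λ u → 0# < r u) us → ∀ r⁺ t → Thresholded r⁺ →
    𝔼 (processLevel G q i r us (r⁺ , t)) f ≤ (t + η ∙ r⁺) + ∑ₗ us (λ u → charge i η u (r u))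
  processLevel-bound i i<L r f η f≤ {[]} [] r⁺ t r⁺-thr = begin
    𝔼 (return (r⁺ , t)) f  ≈⟨ 𝔼-return (r⁺ , t) f ⟩
    f (r⁺ , t)             ≤⟨ f≤ r⁺ t r⁺-thr ⟩
    t + η ∙ r⁺             ≈⟨ +-identityʳ _ ⟨
    (t + η ∙ r⁺) + 0#      ∎
  processLevel-bound i i<L r f η f≤ {u ∷ us} (0<ru ∷ 0<r) r⁺ t r⁺-thr = begin
    𝔼 (selection >>= rest) f
      ≈⟨ 𝔼->>= selection rest f ⟩
    𝔼 selection (λ S → 𝔼 (rest S) f)
      ≤⟨ 𝔼-mono-≤ (selection-nonNegative i u (r u) 0<ru) (λ S →
           processLevel-bound i i<L r f η f≤ 0<r (push S r⁺) _ (push-thresholded i u (r u) S r⁺-thr)) ⟩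
    𝔼 selection (λ S → ((t + (sampleTime G q i u (r u) S + B * (1# + fromℕ (length S)))) + η ∙ push S r⁺)
                         + ∑ₗ us (λ u → charge i η u (r u)))
      ≤⟨ step-bound i u (r u) 0<ru i<L η r⁺ t (∑ₗ us (λ u → charge i η u (r u))) ⟩
    (t + η ∙ r⁺) + (charge i η u (r u) + ∑ₗ us (λ u → charge i η u (r u)))
      ∎
    where
    open Step G q e i u (r u)
    rest : List (Fin n) → Dist (Vector n × Carrier)
    rest S = processLevel G q i r us
      (push S r⁺ , t + (sampleTime G q i u (r u) S + B * (1# + fromℕ (length S))))

  -- φ m i u is the total mass that a unit of r̂⁽ⁱ⁾(u) sends, in expectation, to the
  -- levels i + 1, …, i + m.
  φ : ℕ → ℕ → Vector n
  φ zero    i u = 0#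
  φ (suc m) i u = ratio i * sum (λ v → (1# + φ m (suc i) v) * M v u)

  propagate-bound : ∀ m i → m ℕ.+ i ≡.≡ L → ∀ r π t → (∀ v → 0# ≤ r v) →
    𝔼 (propagate G q m i r π t) proj₂ ≤
    t + ((A * cₒ) * fromℕ (length (support r)) + (H + H) * (φ m i ∙ r))
  propagate-bound zero i _ r π t 0≤r = begin
    𝔼 (propagate G q zero i r π t) proj₂
      ≈⟨ 𝔼-return ((λ v → π v + ((w i ÷ Y i) * r v)) , t) proj₂ ⟩
    t
      ≤⟨ x≤x+y t (*-nonNeg (*-nonNeg 0≤A 0≤cₒ) (fromℕ-nonNeg (length (support r)))) ⟩
    t + (A * cₒ) * fromℕ (length (support r))
      ≈⟨ +-congˡ (trans (+-congˡ (trans (*-congˡ φ∙r≈0) (zeroʳ (H + H)))) (+-identityʳ _)) ⟨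
    t + ((A * cₒ) * fromℕ (length (support r)) + (H + H) * (φ zero i ∙ r))
      ∎
    where
    φ∙r≈0 : φ zero i ∙ r ≈ 0#
    φ∙r≈0 = trans (sum-cong-≋ {n} (λ v → zeroˡ (r v))) (sum-replicate-zero n)
  propagate-bound (suc m) i m+i≡L r π t 0≤r = begin
    𝔼 (processLevel G q i r (support r) (0ᵥ , t) >>= next) proj₂
      ≈⟨ 𝔼->>= (processLevel G q i r (support r) (0ᵥ , t)) next proj₂ ⟩
    𝔼 (processLevel G q i r (support r) (0ᵥ , t)) f
      ≤⟨ processLevel-bound i i<L r f η f≤ support-pos 0ᵥ t (λ _ → inj₁ refl) ⟩
    (t + η ∙ 0ᵥ) + ∑ₗ (support r) (λ u → charge i η u (r u))
      ≈⟨ +-cong (trans (+-congˡ η∙0≈0) (+-identityʳ t)) ∑-charge ⟩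
    t + ((A * cₒ) * fromℕ (length (support r)) + (H + H) * (φ (suc m) i ∙ r))
      ∎
    where
    i<L : i ℕ.< L
    i<L = ≡.subst (suc i ℕ.≤_) m+i≡L (ℕ.s≤s (ℕ.m≤n+m i m))
    0ᵥ : Vector n
    0ᵥ _ = 0#
    π⁺ : Vector n
    π⁺ v = π v + ((w i ÷ Y i) * r v)
    next : Vector n × Carrier → Dist (Vector n × Carrier)
    next (r⁺ , t⁺) = propagate G q m (suc i) r⁺ π⁺ t⁺
    f : Vector n × Carrier → Carrier
    f s = 𝔼 (next s) proj₂
    η : Vector n
    η v = H + (H + H) * φ m (suc i) v

    support-pos : All (λ u → 0# < r u) (support r)
    support-pos = All.map (λ {u} → 0≤∧≉0⇒0< (0≤r u)) (All.all-filter (λ u → ¬? (r u ≟ 0#)) (allFin n))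

    η∙0≈0 : η ∙ 0ᵥ ≈ 0#
    η∙0≈0 = trans (sum-cong-≋ {n} (λ v → zeroʳ (η v))) (sum-replicate-zero n)

    f≤ : ∀ r⁺ t⁺ → Thresholded r⁺ → f (r⁺ , t⁺) ≤ t⁺ + η ∙ r⁺
    f≤ r⁺ t⁺ r⁺-thr = begin
      f (r⁺ , t⁺)
        ≤⟨ propagate-bound m (suc i) (≡.trans (ℕ.+-suc m i) m+i≡L) r⁺ π⁺ t⁺ (thresholded-nonNeg r⁺-thr) ⟩
      t⁺ + ((A * cₒ) * fromℕ (length (support r⁺)) + (H + H) * (φ m (suc i) ∙ r⁺))
        ≤⟨ +-monoʳ-≤ t⁺ (+-monoˡ-≤ _ (*-monoˡ-≤ (*-nonNeg 0≤A 0≤cₒ) (length-support-≤ r⁺-thr))) ⟩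
      t⁺ + ((A * cₒ) * ((1# ÷ e) * sum r⁺) + (H + H) * (φ m (suc i) ∙ r⁺))
        ≈⟨ +-congˡ (+-cong (solve 4 (λ a c d s → (a :* c) :* (d :* s) := (a :* (c :* d)) :* s)
             refl A cₒ (1# ÷ e) (sum r⁺)) refl) ⟩
      t⁺ + (H * sum r⁺ + (H + H) * (φ m (suc i) ∙ r⁺))
        ≈⟨ +-congˡ (+-cong (*-distribˡ-sum {n} H r⁺)
           (*-distribˡ-sum {n} (H + H) (λ v → φ m (suc i) v * r⁺ v))) ⟩
      t⁺ + (sum (λ v → H * r⁺ v) + sum (λ v → (H + H) * (φ m (suc i) v * r⁺ v)))
        ≈⟨ +-congˡ (∑-distrib-+ {n} (λ v → H * r⁺ v) (λ v → (H + H) * (φ m (suc i) v * r⁺ v))) ⟨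
      t⁺ + sum (λ v → H * r⁺ v + (H + H) * (φ m (suc i) v * r⁺ v))
        ≈⟨ +-congˡ (sum-cong-≋ {n} (λ v →
             solve 3 (λ h p x → h :* x :+ (h :+ h) :* (p :* x) := (h :+ (h :+ h) :* p) :* x)
               refl H (φ m (suc i) v) (r⁺ v))) ⟩
      t⁺ + η ∙ r⁺
        ∎

    charge≈ : ∀ u → charge i η u (r u) ≈ A * cₒ + r u * ((H + H) * φ (suc m) i u)
    charge≈ u = +-congˡ (trans (∑-share i u (r u) (λ v → H + η v)) (*-congˡ (begin-equality
      ratio i * sum (λ v → (H + η v) * M v u)
        ≈⟨ *-congˡ (sum-cong-≋ {n} (λ v →
             solve 3 (λ h p x → (h :+ (h :+ (h :+ h) :* p)) :* x := (h :+ h) :* ((con 1 :+ p) :* x))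
               refl H (φ m (suc i) v) (M v u))) ⟩
      ratio i * sum (λ v → (H + H) * ((1# + φ m (suc i) v) * M v u))
        ≈⟨ *-congˡ (*-distribˡ-sum {n} (H + H) (λ v → (1# + φ m (suc i) v) * M v u)) ⟨
      ratio i * ((H + H) * sum (λ v → (1# + φ m (suc i) v) * M v u))
        ≈⟨ solve 3 (λ x y z → x :* (y :* z) := y :* (x :* z)) refl (ratio i) (H + H) _ ⟩
      (H + H) * φ (suc m) i u
        ∎)))

    ∑-charge : ∑ₗ (support r) (λ u → charge i η u (r u)) ≈
               (A * cₒ) * fromℕ (length (support r)) + (H + H) * (φ (suc m) i ∙ r)
    ∑-charge = begin-equality
      ∑ₗ (support r) (λ u → charge i η u (r u))
        ≈⟨ ∑ₗ-cong (support r) charge≈ ⟩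
      ∑ₗ (support r) (λ u → A * cₒ + r u * ((H + H) * φ (suc m) i u))
        ≈⟨ ∑ₗ-+ (support r) (λ _ → A * cₒ) (λ u → r u * ((H + H) * φ (suc m) i u)) ⟩
      ∑ₗ (support r) (λ _ → A * cₒ) + ∑ₗ (support r) (λ u → r u * ((H + H) * φ (suc m) i u))
        ≈⟨ +-cong (∑ₗ-const (support r) (A * cₒ)) (∑-support r (λ u → (H + H) * φ (suc m) i u)) ⟩
      (A * cₒ) * fromℕ (length (support r)) + sum (λ u → ((H + H) * φ (suc m) i u) * r u)
        ≈⟨ +-congˡ (sum-cong-≋ {n} (λ u → *-assoc (H + H) (φ (suc m) i u) (r u))) ⟩
      (A * cₒ) * fromℕ (length (support r)) + sum (λ u → (H + H) * (φ (suc m) i u * r u))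
        ≈⟨ +-congˡ (*-distribˡ-sum {n} (H + H) (λ u → φ (suc m) i u * r u)) ⟨
      (A * cₒ) * fromℕ (length (support r)) + (H + H) * (φ (suc m) i ∙ r)
        ∎

  P : ℕ → Vector n
  P i = (M ^ₘ i) *ᵥ x

  -- Multiplying by Y i removes the normalisation r̂⁽ⁱ⁾ ↦ r̂⁽ⁱ⁾ / Y i, also when Y i is 0.
  Y*φ∙P : ∀ m i → Y i * (φ m i ∙ P i) ≈
          sum (λ (k : Fin m) → Y (suc (toℕ k ℕ.+ i)) * sum (P (suc (toℕ k ℕ.+ i))))
  Y*φ∙P zero    i = trans
    (*-congˡ (trans (sum-cong-≋ {n} (λ v → zeroˡ (P i v))) (sum-replicate-zero n)))
    (zeroʳ (Y i))
  Y*φ∙P (suc m) i = begin-equality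
    Y i * (φ (suc m) i ∙ P i)
      ≈⟨ *-congˡ push-out ⟩
    Y i * (ratio i * sum (λ v → (1# + φ m (suc i) v) * P (suc i) v))
      ≈⟨ *-assoc (Y i) (ratio i) _ ⟨
    (Y i * ratio i) * sum (λ v → (1# + φ m (suc i) v) * P (suc i) v)
      ≈⟨ *-cong (Y*ratio i) (trans (sum-cong-≋ {n} (λ v →
           solve 2 (λ p x → (con 1 :+ p) :* x := x :+ p :* x) refl (φ m (suc i) v) (P (suc i) v)))
           (∑-distrib-+ {n} (P (suc i)) (λ v → φ m (suc i) v * P (suc i) v))) ⟩
    Y (suc i) * (sum (P (suc i)) + φ m (suc i) ∙ P (suc i))
      ≈⟨ distribˡ (Y (suc i)) _ _ ⟩
    Y (suc i) * sum (P (suc i)) + Y (suc i) * (φ m (suc i) ∙ P (suc i))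
      ≈⟨ +-congˡ (Y*φ∙P m (suc i)) ⟩
    Y (suc i) * sum (P (suc i)) +
      sum (λ (k : Fin m) → Y (suc (toℕ k ℕ.+ suc i)) * sum (P (suc (toℕ k ℕ.+ suc i))))
      ≈⟨ +-congˡ (sum-cong-≋ {m} (λ k →
           reflexive (≡.cong (λ j → Y (suc j) * sum (P (suc j))) (ℕ.+-suc (toℕ k) i)))) ⟩
    sum (λ (k : Fin (suc m)) → Y (suc (toℕ k ℕ.+ i)) * sum (P (suc (toℕ k ℕ.+ i))))
      ∎
    where
    h : Vector n
    h v = 1# + φ m (suc i) v
    push-out : φ (suc m) i ∙ P i ≈ ratio i * sum (λ v → h v * P (suc i) v)
    push-out = begin-equality
      sum (λ u → (ratio i * sum (λ v → h v * M v u)) * P i u)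
        ≈⟨ sum-cong-≋ {n} (λ u → trans (*-assoc (ratio i) _ (P i u))
             (*-congˡ (*-distribʳ-sum {n} (P i u) (λ v → h v * M v u)))) ⟩
      sum (λ u → ratio i * sum (λ v → (h v * M v u) * P i u))
        ≈⟨ *-distribˡ-sum {n} (ratio i) (λ u → sum (λ v → (h v * M v u) * P i u)) ⟨
      ratio i * sum (λ u → sum (λ v → (h v * M v u) * P i u))
        ≈⟨ *-congˡ (∑-comm {n} {n} (λ u v → (h v * M v u) * P i u)) ⟩
      ratio i * sum (λ v → sum (λ u → (h v * M v u) * P i u))
        ≈⟨ *-congˡ (sum-cong-≋ {n} (λ v → trans (sum-cong-≋ {n} (λ u → *-assoc (h v) (M v u) (P i u)))
             (sym (*-distribˡ-sum {n} (h v) (λ u → M v u * P i u))))) ⟩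
      ratio i * sum (λ v → h v * (M *ᵥ P i) v)
        ≈⟨ *-congˡ (sum-cong-≋ {n} (λ v → *-congˡ (*ₘ-*ᵥ-assoc M (M ^ₘ i) x v))) ⟨
      ratio i * sum (λ v → h v * P (suc i) v)
        ∎

  W : Carrier
  W = ∑[1⋯ L ] (λ i → ‖ Y i • ((M ^ₘ i) *ᵥ x) ‖₁)

  0≤W : 0# ≤ W
  0≤W = sum-nonNeg {L} (λ k → sum-nonNeg {n} (λ v → 0≤∣x∣ _))

  φ∙x≤W : φ L 0 ∙ x ≤ W
  φ∙x≤W = begin
    φ L 0 ∙ x
      ≈⟨ sum-cong-≋ {n} (λ u → *-congˡ (sum-indicator u x)) ⟨
    φ L 0 ∙ P 0
      ≈⟨ trans (*-congʳ Y0≈1) (*-identityˡ _) ⟨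
    Y 0 * (φ L 0 ∙ P 0)
      ≈⟨ Y*φ∙P L 0 ⟩
    sum (λ (k : Fin L) → Y (suc (toℕ k ℕ.+ 0)) * sum (P (suc (toℕ k ℕ.+ 0))))
      ≈⟨ sum-cong-≋ {L} (λ k → reflexive
           (≡.cong (λ j → Y (suc j) * sum (P (suc j))) (ℕ.+-identityʳ (toℕ k)))) ⟩
    ∑[1⋯ L ] (λ i → Y i * sum (P i))
      ≤⟨ sum-mono-≤ {L} (λ k → ≤-trans
           (≤-reflexive (*-distribˡ-sum {n} (Y (suc (toℕ k))) (P (suc (toℕ k)))))
           (sum-mono-≤ {n} (λ v → x≤∣x∣ _))) ⟩
    W
      ∎

  support-x-nonempty : 1# ≤ fromℕ (length (support x))
  support-x-nonempty with support x | ∑-support x (λ _ → 1#)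
  ... | _ ∷ us | _     = 1≤fromℕ-suc (length us)
  ... | []     | 0≈1∙x = ⊥-elim (0≉1 (begin-equality
    0#             ≈⟨ 0≈1∙x ⟩
    (λ _ → 1#) ∙ x ≈⟨ sum-cong-≋ {n} (λ v → trans (*-identityˡ (x v)) (sym (0≤x⇒∣x∣≈x (0≤x v)))) ⟩
    ‖ x ‖₁         ≈⟨ ‖x‖₁≈1 ⟩
    1#             ∎))

  initTime-nonNeg : 0# ≤ initTime G q
  initTime-nonNeg with total 0# (initTime G q)
  ... | inj₁ 0≤I = 0≤I
  ... | inj₂ I≤0 = ⊥-elim (1≰0 (begin
    1#                                   ≤⟨ support-x-nonempty ⟩
    fromℕ (length (support x))           ≈⟨ *-identityˡ _ ⟨
    1# * fromℕ (length (support x))      ≤⟨ *-monoʳ-≤ (fromℕ-nonNeg (length (support x))) (1≤cₛₒ G) ⟩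
    cₒ * fromℕ (length (support x))      ≤⟨ initTime-bound G q ⟩
    κ * initTime G q                     ≤⟨ nonNeg*nonPos 0≤κ I≤0 ⟩
    0#                                   ∎))

  expectedQueryTime-bound :
    expectedQueryTime G q ≤ (1# + A * (κ + (1# + 1#))) * ((cₒ * (1# ÷ e)) * W + initTime G q)
  expectedQueryTime-bound = begin
    expectedQueryTime G q
      ≤⟨ propagate-bound L 0 (ℕ.+-identityʳ L) x (λ _ → 0#) I 0≤x ⟩
    I + ((A * cₒ) * fromℕ (length (support x)) + (H + H) * (φ L 0 ∙ x))
      ≤⟨ +-monoʳ-≤ I (+-mono-≤
           (≤-trans (≤-reflexive (*-assoc A cₒ _)) (*-monoˡ-≤ 0≤A (initTime-bound G q)))
           (*-monoˡ-≤ (+-nonNeg 0≤H 0≤H) φ∙x≤W)) ⟩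
    I + (A * (κ * I) + (H + H) * W)
      ≤⟨ x≤x+y _ (+-nonNeg 0≤X (+-nonNeg (*-nonNeg 0≤A (*-nonNeg 0≤κ 0≤X)) (*-nonNeg 0≤A (+-nonNeg 0≤I 0≤I)))) ⟩
    (I + (A * (κ * I) + (H + H) * W)) + (X + (A * (κ * X) + A * (I + I)))
      ≈⟨ solve 5 (λ A κ I d W →
           (I :+ (A :* (κ :* I) :+ (A :* d :+ A :* d) :* W)) :+
           (d :* W :+ (A :* (κ :* (d :* W)) :+ A :* (I :+ I))) :=
           (con 1 :+ A :* (κ :+ (con 1 :+ con 1))) :* (d :* W :+ I))
           refl A κ I (cₒ * (1# ÷ e)) W ⟩
    (1# + A * (κ + (1# + 1#))) * (X + I)
      ∎
    where
    I : Carrier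
    I = initTime G q
    0≤I : 0# ≤ I
    0≤I = initTime-nonNeg
    X : Carrier
    X = (cₒ * (1# ÷ e)) * W
    0≤X : 0# ≤ X
    0≤X = *-nonNeg (*-nonNeg 0≤cₒ 0≤1÷e) 0≤W
    0≤H : 0# ≤ H
    0≤H = *-nonNeg 0≤A (*-nonNeg 0≤cₒ 0≤1÷e)

theorem1 : ∀ {c ℓ₁ ℓ₂} (R : RealNumbers c ℓ₁ ℓ₂) →
  let open RealNumbers R
      open Propagation R
      open AGPAlgorithm
      open Query
  in
  (alg : AGPAlgorithm) →
  ∃ λ (C : Carrier) → (0# < C) ×
    ((n : ℕ) (G : Graph n) (q : Query n) →
      expectedQueryTime alg G q
        ≤ (C * (((cₛₒ alg G * (1# ÷ ε alg G q)) *
                 ∑[1⋯ L q ] (λ i → ‖ Y q i • ((propagationMatrix G (a q) (b q) ^ₘ i) *ᵥ x q) ‖₁))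
                + initTime alg G q)))
theorem1 R alg =
  1# + (K + B) * (κ + (1# + 1#)) ,
  1≤⇒0< (x≤x+y 1# (*-nonNeg (+-nonNeg 0≤K 0≤B) (+-nonNeg 0≤κ (+-nonNeg 0≤1 0≤1)))) ,
  λ n G q → Analysis.expectedQueryTime-bound R alg G q
  where
  open RealNumbers R
  open RealProperties R
  open Propagation.AGPAlgorithm alg
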